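{- $A\in \kappa\mathbf{CH}$ if and only if $\mathcal{BL}_\kappa(\mathrm{p}\mathcal{H} A) = A$.
   Context: Let $A$ be a meet-semilattice (in the paper, a bounded distributive lattice) and $\kappa$ a regular cardinal. A $\kappa$-join is a join of a set of cardinality $<\kappa$; $A$ is $\kappa$-complete if all $\kappa$-joins exist. $\kappa\mathbf{CH}$ is the class of $\kappa$-complete Heyting lattices. A join $\bigvee S$ existing in $A$ is distributive if $a\wedge\bigvee S=\bigvee\{a\wedge s: s\in S\}$ for all $a\in A$; $A$ is a $\kappa$-frame if it is $\kappa$-complete and every $\kappa$-join is distributive. $\mathcal{BL} A$ (the Bruns-Lakser completion) is the frame of D-ideals of $A$ (downsets closed under distributive joins of their subsets), with $A$ identified with its principal downsets. A relative annihilator of $A$ is $\langle a,b\rangle=\{x\in A: a\wedge x\le b\}$. The proHeyting extension $\mathrm{p}\mathcal{H} A$ is the bounded sublattice of $\mathcal{BL} A$ generated by the relative annihilators of $A$; one has $A\subseteq\mathrm{p}\mathcal{H} A\subseteq\mathcal{BL} A$ and $\mathcal{BL}(\mathrm{p}\mathcal{H} A)$ is identified with $\mathcal{BL} A$. For a meet-semilattice $B$ with $A\le B\le\mathcal{BL} A$, $\mathcal{BL}_\kappa B$ denotes the sub-$\kappa$-frame of $\mathcal{BL} A=\mathcal{BL} B$ generated by $B$. -}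

module Defs where

open import Data.Empty.Polymorphic using () renaming (⊥ to Empty)
open import Data.Nat.Base using (ℕ)
open import Data.Product.Base using (Σ; Σ-syntax; ∃; ∃₂; _×_; _,_; proj₁; proj₂)
open import Data.Sum.Base using ([_,_])
import Data.Sum.Base as Sum
open import Data.Unit.Polymorphic using () renaming (⊤ to Unit)
open import Function.Base using (id; _∘_)
open import Function.Bundles using (_↣_)
open import Level using (Level; _⊔_; suc)
open import Relation.Binary.Core using (Rel)
open import Relation.Binary.Lattice.Bundles using (MeetSemilattice; BoundedLattice)
open import Relation.Binary.Lattice.Structures using (IsHeytingAlgebra)
open import Relation.Nullary.Negation using (¬_)
open import Relation.Unary using (Pred; _∈_; _⊆_; _≐_; _∩_; _∪_; ⋃)

private
  variable
    a i r : Level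

-- Cardinals are represented by types, and a set of elements of cardinality < κ
-- by a family indexed by a type of cardinality < κ.

_<ᶜ_ : Set a → Set r → Set (a ⊔ r)
I <ᶜ K = (I ↣ K) × ¬ (K ↣ I)

record RegularCardinal (ℓ : Level) : Set (suc ℓ) where
  field
    ⟦_⟧      : Set ℓ
    infinite : ℕ ↣ ⟦_⟧
    -- A sum of fewer than κ cardinals, each less than κ, is less than κ.
    regular  : {I : Set ℓ} (J : I → Set ℓ) →
               I <ᶜ ⟦_⟧ → (∀ k → J k <ᶜ ⟦_⟧) → Σ I J <ᶜ ⟦_⟧

open RegularCardinal public using (⟦_⟧)

IsJoin : {A : Set a} → Rel A r → {I : Set i} → (I → A) → A → Set (a ⊔ r ⊔ i)
IsJoin _≤_ f x = (∀ k → f k ≤ x) × (∀ y → (∀ k → f k ≤ y) → x ≤ y)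

-- Carrier, equality, order and index types live at a single level ℓ, so that
-- the families indexed by types in Set ℓ are, up to their range, exactly the
-- subsets Pred Carrier ℓ.

module _ {ℓ : Level} (A : MeetSemilattice ℓ ℓ ℓ) where
  open MeetSemilattice A

  IsDistributiveJoin : {I : Set ℓ} → (I → Carrier) → Carrier → Set ℓ
  IsDistributiveJoin f x =
    IsJoin _≤_ f x × (∀ a → IsJoin _≤_ (λ k → a ∧ f k) (a ∧ x))

  record DIdeal : Set (suc ℓ) where
    field
      Member      : Pred Carrier ℓ
      down-closed : ∀ {x y} → x ≤ y → Member y → Member x
      join-closed : ∀ {I : Set ℓ} {f : I → Carrier} {x} →
                    IsDistributiveJoin f x → (∀ k → Member (f k)) → Member x

module _ {ℓ : Level} {A : MeetSemilattice ℓ ℓ ℓ} where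
  open MeetSemilattice A
  open DIdeal

  infix 4 _≤ᴰ_ _≈ᴰ_

  _≤ᴰ_ : Rel (DIdeal A) ℓ
  D ≤ᴰ E = Member D ⊆ Member E

  _≈ᴰ_ : Rel (DIdeal A) ℓ
  D ≈ᴰ E = Member D ≐ Member E

  private
    ∧-monoʳ : ∀ a {x y} → x ≤ y → (a ∧ x) ≤ (a ∧ y)
    ∧-monoʳ a x≤y = ∧-greatest (x∧y≤x a _) (trans (x∧y≤y a _) x≤y)

  ↓ : Carrier → DIdeal A
  ↓ a = record
    { Member      = _≤ a
    ; down-closed = trans
    ; join-closed = λ x-join f≤a → proj₂ (proj₁ x-join) a f≤a
    }

  relAnn : Carrier → Carrier → DIdeal A
  relAnn a b = record
    { Member      = λ x → (a ∧ x) ≤ b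
    ; down-closed = λ x≤y ay≤b → trans (∧-monoʳ a x≤y) ay≤b
    ; join-closed = λ x-join af≤b → proj₂ (proj₂ x-join a) b af≤b
    }

  Below : Pred Carrier ℓ → Carrier → Set ℓ
  Below U x = Σ[ u ∈ Carrier ] (∃ λ v → v ∈ U × u ≤ v) × u ≤ x

  -- The D-ideal generated by U: its elements are the distributive joins of
  -- subsets of the downset of U; the largest subset that can have join x
  -- consists of the elements of that downset below x, so it suffices to test it.

  ⟨_⟩ : Pred Carrier ℓ → DIdeal A
  ⟨ U ⟩ = record
    { Member      = λ x → IsDistributiveJoin A {Below U x} proj₁ x
    ; down-closed = λ {x} {y} x≤y y-join →
        let least : ∀ a z → (∀ (k : Below U x) → (a ∧ proj₁ k) ≤ z) → (a ∧ x) ≤ z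
            least a z h =
              trans (∧-greatest (∧-greatest (x∧y≤x a x) (x∧y≤y a x))
                                (trans (x∧y≤y a x) x≤y))
                    (proj₂ (proj₂ y-join (a ∧ x)) z λ where
                      (u , (v , v∈U , u≤v) , _) →
                        trans (∧-greatest (trans (x∧y≤x _ _) (x∧y≤x a x))
                                 (∧-greatest (trans (x∧y≤x _ _) (x∧y≤y a x))
                                             (x∧y≤y _ _)))
                              (h (x ∧ u , (v , v∈U , trans (x∧y≤y x u) u≤v) , x∧y≤x x u)))
        in distributive least
    ; join-closed = λ {I} {f} {x} x-join f∈ →
        distributive λ a z h → proj₂ (proj₂ x-join a) z λ k →
          proj₂ (proj₂ (f∈ k) a) z λ where
            (u , u∈ , u≤fk) → h (u , u∈ , trans u≤fk (proj₁ (proj₁ x-join) k))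
    }
    where
    distributive : ∀ {x} →
      (∀ a z → (∀ (k : Below U x) → (a ∧ proj₁ k) ≤ z) → (a ∧ x) ≤ z) →
      IsDistributiveJoin A {Below U x} proj₁ x
    distributive {x} least =
      ( (λ k → proj₂ (proj₂ k))
      , λ y h → trans (∧-greatest refl refl)
                      (least x y λ k → trans (x∧y≤y x _) (h k)))
      , λ a → (λ k → ∧-monoʳ a (proj₂ (proj₂ k))) , least a

  ⟨⟩-extensive : ∀ {U} → U ⊆ Member ⟨ U ⟩
  ⟨⟩-extensive {U} {x} x∈U =
    ( (λ k → proj₂ (proj₂ k)) , λ y h → h top)
    , λ a → (λ k → ∧-monoʳ a (proj₂ (proj₂ k))) , λ y h → h top
    where
    top : Below U x
    top = x , (x , x∈U , refl) , refl

  ⟨⟩-least : ∀ {U} D → U ⊆ Member D → ⟨ U ⟩ ≤ᴰ D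
  ⟨⟩-least D U⊆D x-join =
    join-closed D x-join λ where (u , (v , v∈U , u≤v) , _) → down-closed D u≤v (U⊆D v∈U)

  ⋁ : {I : Set ℓ} → (I → DIdeal A) → DIdeal A
  ⋁ {I} f = ⟨ ⋃ I (Member ∘ f) ⟩

  ⋁-isJoin : {I : Set ℓ} (f : I → DIdeal A) → IsJoin _≤ᴰ_ f (⋁ f)
  ⋁-isJoin f =
      (λ k x∈ → ⟨⟩-extensive (k , x∈))
    , λ D f≤D → ⟨⟩-least D λ where (k , x∈) → f≤D k x∈

module _ {ℓ : Level} (A : MeetSemilattice ℓ ℓ ℓ) where
  open MeetSemilattice A using (Carrier)
  open DIdeal

  BL : BoundedLattice (suc ℓ) ℓ ℓ
  BL = record
    { Carrier = DIdeal A
    ; _≈_     = _≈ᴰ_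
    ; _≤_     = _≤ᴰ_
    ; _∨_     = λ D E → ⟨ Member D ∪ Member E ⟩
    ; _∧_     = λ D E → record
        { Member      = Member D ∩ Member E
        ; down-closed = λ where
            x≤y (y∈D , y∈E) → down-closed D x≤y y∈D , down-closed E x≤y y∈E
        ; join-closed = λ x-join f∈ →
            join-closed D x-join (proj₁ ∘ f∈) , join-closed E x-join (proj₂ ∘ f∈)
        }
    ; ⊤       = record
        { Member      = λ _ → Unit
        ; down-closed = _
        ; join-closed = _
        }
    ; ⊥       = ⟨ (λ _ → Empty) ⟩
    ; isBoundedLattice = record
        { isLattice = record
            { isPartialOrder = record
                { isPreorder = record
                    { isEquivalence = record
                        { refl  = id , id
                        ; sym   = λ where (p , q) → q , p
                        ; trans = λ where (p , q) (p′ , q′) → p′ ∘ p , q ∘ q′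
                        }
                    ; reflexive = proj₁
                    ; trans     = λ p q → q ∘ p
                    }
                ; antisym = _,_
                }
            ; supremum = λ D E →
                  (λ x∈ → ⟨⟩-extensive {A = A} {U = Member D ∪ Member E} (Sum.inj₁ x∈))
                , (λ x∈ → ⟨⟩-extensive {A = A} {U = Member D ∪ Member E} (Sum.inj₂ x∈))
                , λ F D≤F E≤F → ⟨⟩-least F [ D≤F , E≤F ]
            ; infimum  = λ D E →
                proj₁ , proj₂ , λ F F≤D F≤E x∈ → F≤D x∈ , F≤E x∈
            }
        ; maximum = _
        ; minimum = λ D → ⟨⟩-least D λ ()
        }
    }

  BL-frame : {I : Set ℓ} (f : I → DIdeal A) (D : DIdeal A) →
             let open BoundedLattice BL in D ∧ ⋁ f ≤ ⋁ (λ k → D ∧ f k)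
  BL-frame {I} f D {x} (x∈D , x-join) =
    join-closed (⋁ (λ k → D ∧ f k)) x-join λ where
      (u , (v , (k , v∈fk) , u≤v) , u≤x) →
        ⟨⟩-extensive {A = A} {U = ⋃ I (λ k → Member (D ∧ f k))}
          (k , down-closed D u≤x x∈D , down-closed (f k) u≤v v∈fk)
    where open BoundedLattice BL using (_∧_)

  IsPrincipal : Pred (DIdeal A) ℓ
  IsPrincipal D = ∃ λ a → D ≈ᴰ ↓ a

  IsRelativeAnnihilator : Pred (DIdeal A) ℓ
  IsRelativeAnnihilator D = ∃₂ λ a b → D ≈ᴰ relAnn a b

module _ {c ℓ₁ ℓ₂ p : Level} (L : BoundedLattice c ℓ₁ ℓ₂) where
  open BoundedLattice L

  data BoundedSublattice (P : Pred Carrier p) : Pred Carrier (c ⊔ ℓ₁ ⊔ p) where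
    gen  : ∀ {x} → P x → BoundedSublattice P x
    resp : ∀ {x y} → x ≈ y → BoundedSublattice P x → BoundedSublattice P y
    top  : BoundedSublattice P ⊤
    bot  : BoundedSublattice P ⊥
    meet : ∀ {x y} → BoundedSublattice P x → BoundedSublattice P y →
           BoundedSublattice P (x ∧ y)
    join : ∀ {x y} → BoundedSublattice P x → BoundedSublattice P y →
           BoundedSublattice P (x ∨ y)

  -- Finite joins are κ-joins, as κ is infinite.
  data SubκFrame {k : Level} (κ : RegularCardinal k) (P : Pred Carrier p) :
       Pred Carrier (c ⊔ ℓ₁ ⊔ ℓ₂ ⊔ p ⊔ suc k) where
    gen   : ∀ {x} → P x → SubκFrame κ P x
    resp  : ∀ {x y} → x ≈ y → SubκFrame κ P x → SubκFrame κ P y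
    top   : SubκFrame κ P ⊤
    meet  : ∀ {x y} → SubκFrame κ P x → SubκFrame κ P y → SubκFrame κ P (x ∧ y)
    κjoin : ∀ {I : Set k} {f : I → Carrier} {x} → I <ᶜ ⟦ κ ⟧ →
            (∀ j → SubκFrame κ P (f j)) → IsJoin _≤_ f x → SubκFrame κ P x

module _ {ℓ : Level} (A : MeetSemilattice ℓ ℓ ℓ) where

  pH : Pred (DIdeal A) (suc ℓ)
  pH = BoundedSublattice (BL A) (IsRelativeAnnihilator A)

  -- B is given as a subset of BL A.
  BLκ : RegularCardinal ℓ → Pred (DIdeal A) (suc ℓ) → Pred (DIdeal A) (suc ℓ)
  BLκ κ B = SubκFrame (BL A) κ B

module _ {ℓ : Level} (κ : RegularCardinal ℓ) (A : BoundedLattice ℓ ℓ ℓ) where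
  open BoundedLattice A

  κComplete : Set (suc ℓ)
  κComplete = ∀ {I : Set ℓ} → I <ᶜ ⟦ κ ⟧ → (f : I → Carrier) → ∃ (IsJoin _≤_ f)

  IsHeyting : Set ℓ
  IsHeyting = ∃ λ _⇨_ → IsHeytingAlgebra _≈_ _≤_ _∨_ _∧_ _⇨_ ⊤ ⊥

  κCH : Set (suc ℓ)
  κCH = κComplete × IsHeyting

{-# OPTIONS --safe #-}

-- In a Heyting algebra every existing join is distributive, so the principal
-- D-ideals are closed under all joins that exist in A.  Conversely, the
-- generator of a principal D-ideal ⋁ ↓ (f k) is a join of f, and the generator
-- of a principal relative annihilator ⟨ a , b ⟩ is a ⇨ b.

module Submission where

open import Defs
open import Data.Bool.Base using (Bool; true; false)
open import Data.Empty.Polymorphic using () renaming (⊥ to Empty)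
open import Data.Product.Base using (_,_; proj₁; proj₂)
open import Function.Bundles using (_⇔_; mk⇔)
open import Level using (Level; Lift; lift)
open import Relation.Binary.Lattice.Bundles using (MeetSemilattice; BoundedLattice)
open import Relation.Binary.Lattice.Structures
  using (IsDistributiveLattice; IsHeytingAlgebra)
open import Relation.Unary using (_≐_; _⊆_)

open DIdeal

module _ {ℓ : Level} (M : MeetSemilattice ℓ ℓ ℓ) where
  open MeetSemilattice M

  -- As `D` contains every `a k`, closure under distributive joins puts `x` in `D`; conversely `↓ x`
  -- bounds the family. Letting `D` be any join of `f`, not just `⋁ f`, makes this cover the bottom,
  -- binary joins and κ-joins alike.
  principal-join : {I : Set ℓ} {f : I → DIdeal M} {D : DIdeal M} {a : I → Carrier} {x : Carrier} →
                   (∀ k → f k ≈ᴰ ↓ {A = M} (a k)) → IsDistributiveJoin M a x →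
                   IsJoin (_≤ᴰ_ {A = M}) f D → D ≈ᴰ ↓ {A = M} x
  principal-join {D = D} {x = x} f≈↓a x-join (f≤D , D-least) =
      D-least (↓ x) (λ k y∈fk → trans (proj₁ (f≈↓a k) y∈fk) (proj₁ (proj₁ x-join) k))
    , λ y≤x → down-closed D y≤x
        (join-closed D x-join λ k → f≤D k (proj₂ (f≈↓a k) refl))

  -- The embedding `↓` reflects joins: if `y` bounds `f`, then `↓ y` bounds the ideals `↓ (f k)`,
  -- hence contains their join, and with it `x`.
  principal-⋁⇒join : {I : Set ℓ} (f : I → Carrier) {x : Carrier} →
                     ⋁ {A = M} (λ k → ↓ (f k)) ≈ᴰ ↓ {A = M} x → IsJoin _≤_ f x
  principal-⋁⇒join f (⋁≤↓x , ↓x≤⋁) =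
      (λ k → ⋁≤↓x (proj₁ (⋁-isJoin {A = M} (λ k → ↓ (f k))) k refl))
    , λ y f≤y → proj₂ (⋁-isJoin {A = M} (λ k → ↓ (f k))) (↓ y)
                  (λ k z≤fk → trans z≤fk (f≤y k)) (↓x≤⋁ refl)

module _ {ℓ : Level} (A : BoundedLattice ℓ ℓ ℓ) where
  open BoundedLattice A

  private
    M = meetSemilattice
    module BLA = BoundedLattice (BL M)

    ∧-swap : ∀ {x y} → (x ∧ y) ≤ (y ∧ x)
    ∧-swap = ∧-greatest (x∧y≤y _ _) (x∧y≤x _ _)

  ↓≈relAnn-⊤ : ∀ a → relAnn {A = M} ⊤ a ≈ᴰ ↓ {A = M} a
  ↓≈relAnn-⊤ a =
      (λ ⊤x≤a → trans (∧-greatest (maximum _) refl) ⊤x≤a)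
    , λ x≤a → trans (x∧y≤y ⊤ _) x≤a

  principal⊆pH : IsPrincipal M ⊆ pH M
  principal⊆pH {D} (a , D≈↓a) =
    gen (⊤ , a , BLA.Eq.trans {D} {↓ a} {relAnn ⊤ a} D≈↓a
                   (BLA.Eq.sym {relAnn ⊤ a} {↓ a} (↓≈relAnn-⊤ a)))

  module _ (_⇨_ : Carrier → Carrier → Carrier)
           (isHeyting : IsHeytingAlgebra _≈_ _≤_ _∨_ _∧_ _⇨_ ⊤ ⊥) where
    open IsHeytingAlgebra isHeyting using (exponential)

    -- Meeting with `a` is left adjoint to `a ⇨_`, so it preserves every join: bounds `y` of the
    -- meets `a ∧ f k` transpose to bounds `a ⇨ y` of `f`.
    join⇒distributiveJoin : {I : Set ℓ} {f : I → Carrier} {x : Carrier} →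
                            IsJoin _≤_ f x → IsDistributiveJoin M f x
    join⇒distributiveJoin {f = f} {x} x-join@(f≤x , x-least) = x-join , λ a →
        (λ k → ∧-greatest (x∧y≤x _ _) (trans (x∧y≤y _ _) (f≤x k)))
      , λ y af≤y → trans ∧-swap (proj₂ (exponential x a y)
          (x-least (a ⇨ y) λ k → proj₁ (exponential (f k) a y) (trans ∧-swap (af≤y k))))

    relAnn≈↓⇨ : ∀ a b → relAnn {A = M} a b ≈ᴰ ↓ {A = M} (a ⇨ b)
    relAnn≈↓⇨ a b =
        (λ {x} ax≤b → proj₁ (exponential x a b) (trans ∧-swap ax≤b))
      , λ {x} x≤a⇨b → trans ∧-swap (proj₂ (exponential x a b) x≤a⇨b)

    principal-resp : {D E : DIdeal M} → D ≈ᴰ E → IsPrincipal M D → IsPrincipal M E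
    principal-resp {D} {E} D≈E (a , D≈↓a) =
      a , BLA.Eq.trans {E} {D} {↓ a} (BLA.Eq.sym {D} {E} D≈E) D≈↓a

    principal-⊤ : IsPrincipal M BLA.⊤
    principal-⊤ = ⊤ , (λ _ → maximum _) , _

    principal-∧ : {D E : DIdeal M} →
                  IsPrincipal M D → IsPrincipal M E → IsPrincipal M (D BLA.∧ E)
    principal-∧ (a , D≤a , a≤D) (b , E≤b , b≤E) =
        a ∧ b
      , (λ (x∈D , x∈E) → ∧-greatest (D≤a x∈D) (E≤b x∈E))
      , λ x≤ab → a≤D (trans x≤ab (x∧y≤x a b)) , b≤E (trans x≤ab (x∧y≤y a b))

    principal-⊥ : IsPrincipal M BLA.⊥
    -- Both bottoms are joins of the empty family, and the empty join in `A` is distributive.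
    principal-⊥ = ⊥ , principal-join M {I = Empty} {f = λ ()} {D = BLA.⊥} {a = λ ()} (λ ())
      (join⇒distributiveJoin ((λ ()) , λ y _ → minimum y))
      ((λ ()) , λ D _ → BLA.minimum D)

    principal-∨ : {D E : DIdeal M} →
                  IsPrincipal M D → IsPrincipal M E → IsPrincipal M (D BLA.∨ E)
    principal-∨ {D} {E} (a , D≈↓a) (b , E≈↓b) =
      -- A binary join is a join over a two-element type, lifted to the level of index types.
      a ∨ b , principal-join M {I = Lift ℓ Bool}
        {f = λ { (lift true) → D ; (lift false) → E }} {D = D BLA.∨ E}
        {a = λ { (lift true) → a ; (lift false) → b }}
        (λ { (lift true) → D≈↓a ; (lift false) → E≈↓b })
        (join⇒distributiveJoin
          ( (λ { (lift true) → x≤x∨y a b ; (lift false) → y≤x∨y a b })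
          , λ y ≤y → ∨-least (≤y (lift true)) (≤y (lift false))))
        ( (λ { (lift true) → BLA.x≤x∨y D E ; (lift false) → BLA.y≤x∨y D E })
        , λ F ≤F → BLA.∨-least {D} {E} {F} (≤F (lift true)) (≤F (lift false)))

    pH⊆principal : pH M ⊆ IsPrincipal M
    pH⊆principal (gen {D} (a , b , D≈)) =
      a ⇨ b , BLA.Eq.trans {D} {relAnn a b} {↓ (a ⇨ b)} D≈ (relAnn≈↓⇨ a b)
    pH⊆principal (resp {D} {E} D≈E D∈) = principal-resp {D} {E} D≈E (pH⊆principal D∈)
    pH⊆principal top = principal-⊤
    pH⊆principal bot = principal-⊥
    pH⊆principal (meet {D} {E} D∈ E∈) =
      principal-∧ {D} {E} (pH⊆principal D∈) (pH⊆principal E∈)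
    pH⊆principal (join {D} {E} D∈ E∈) =
      principal-∨ {D} {E} (pH⊆principal D∈) (pH⊆principal E∈)

    BLκ-pH⊆principal : (κ : RegularCardinal ℓ) → κComplete κ A →
                       BLκ M κ (pH M) ⊆ IsPrincipal M
    BLκ-pH⊆principal κ complete = go
      where
      go : BLκ M κ (pH M) ⊆ IsPrincipal M
      go (gen D∈) = pH⊆principal D∈
      go (resp {D} {E} D≈E D∈) = principal-resp {D} {E} D≈E (go D∈)
      go top = principal-⊤
      go (meet {D} {E} D∈ E∈) = principal-∧ {D} {E} (go D∈) (go E∈)
      go (κjoin {f = f} {x = D} I<κ f∈ D-join) =
        -- The induction hypothesis picks a generator for each `f k`. These are fewer than κ many,
        -- so they have a join in `A`, which is distributive and therefore generates `D`.
        let a , a-join = complete I<κ (λ k → proj₁ (go (f∈ k)))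
        in a , principal-join M {f = f} {D = D} (λ k → proj₂ (go (f∈ k)))
                 (join⇒distributiveJoin a-join) D-join

  -- A generator of `relAnn a b` is the greatest `x` with `a ∧ x ≤ b`, which is what an implication
  -- must be.
  principal-relAnn⇒Heyting : (κ : RegularCardinal ℓ) →
                             (∀ a b → IsPrincipal M (relAnn a b)) → IsHeyting κ A
  principal-relAnn⇒Heyting κ principal =
    (λ a b → proj₁ (principal a b)) , record
      { isBoundedLattice = isBoundedLattice
      ; exponential      = λ w x y →
            (λ wx≤y → proj₁ (proj₂ (principal x y)) (trans ∧-swap wx≤y))
          , λ w≤x⇨y → trans ∧-swap (proj₂ (proj₂ (principal x y)) w≤x⇨y)
      }

theorem4p19 : ∀ {ℓ} (κ : RegularCardinal ℓ) (A : BoundedLattice ℓ ℓ ℓ) →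
    let open BoundedLattice A in
    IsDistributiveLattice _≈_ _≤_ _∨_ _∧_ →
    κCH κ A ⇔ (BLκ meetSemilattice κ (pH meetSemilattice) ≐ IsPrincipal meetSemilattice)
theorem4p19 κ A _ = mk⇔
  (λ (complete , _⇨_ , isHeyting) →
      BLκ-pH⊆principal A _⇨_ isHeyting κ complete
    , λ {D} D-principal → gen (principal⊆pH A {D} D-principal))
  (λ (BLκ⊆principal , _) →
      (λ I<κ f →
        -- The join is first formed among D-ideals, where it always exists; as a κ-join of elements
        -- of `pH` it is principal, so it descends to `A`.
        let x , ⋁≈↓x = BLκ⊆principal {⋁ {A = M} (λ k → ↓ (f k))}
              (κjoin I<κ (λ k → gen (principal⊆pH A {↓ (f k)} (f k , BLA.Eq.refl {↓ (f k)})))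
                (⋁-isJoin (λ k → ↓ (f k))))
        in x , principal-⋁⇒join M f ⋁≈↓x)
    , principal-relAnn⇒Heyting A κ λ a b →
        -- The inner `gen` places the annihilator in `pH`, the outer one places it in the
        -- sub-κ-frame.
        BLκ⊆principal {relAnn a b} (gen (gen (a , b , BLA.Eq.refl {relAnn a b}))))
  where
  M = BoundedLattice.meetSemilattice A
  module BLA = BoundedLattice (BL M)
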